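{- Let $p$ be an odd prime and $r\geq 1$ an integer. Then $O\chi_{\frac{p^r+1}{2}}(QR(p^{2r}))=p^r$.
   Context: For a prime power $q$, $\mathbb{F}_q$ is the finite field of order $q$. The Paley graph $QR(q)$ is the Cayley graph $\Gamma(\mathbb{F}_q,S)$ where $S=\{\alpha^{2m}:1\le m\le \frac{q-1}{2}\}$ is the set of nonzero squares in $\mathbb{F}_q$ ($\alpha$ a primitive element); its vertex set is $\mathbb{F}_q$ and $u,v$ are adjacent iff $u-v\in S$. All colourings are proper vertex colourings. Two colourings are orthogonal if whenever two distinct vertices receive the same colour in one, they receive distinct colours in the other. A $k$-orthogonal colouring is a collection of $k$ pairwise orthogonal proper colourings, and $O\chi_k(G)$ is the minimum number of colours needed for a $k$-orthogonal colouring of $G$. -}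

module Defs where

open import Level using (Level; _⊔_) renaming (suc to lsuc)
open import Data.Nat using (ℕ)
open import Data.Fin using (Fin)
open import Data.Product using (Σ; ∃; _×_)
open import Relation.Nullary using (¬_)
open import Relation.Binary.PropositionalEquality using (_≡_; _≢_)
open import Algebra.Bundles using (CommutativeRing)

record FiniteField (c ℓ : Level) (q : ℕ) : Set (lsuc (c ⊔ ℓ)) where
  field
    commRing : CommutativeRing c ℓ
  open CommutativeRing commRing public hiding (ring)
  field
    1≉0     : ¬ (1# ≈ 0#)
    inverse : ∀ x → ¬ (x ≈ 0#) → ∃ λ y → x * y ≈ 1#
    enum    : Fin q → Carrier
    enum-injective  : ∀ i j → enum i ≈ enum j → i ≡ j
    enum-surjective : ∀ x → ∃ λ i → enum i ≈ x

module _ {c ℓ : Level} {q : ℕ} (F : FiniteField c ℓ q) where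
  open FiniteField F

  IsNonzeroSquare : Carrier → Set (c ⊔ ℓ)
  IsNonzeroSquare x = ¬ (x ≈ 0#) × ∃ λ y → y * y ≈ x

  PaleyAdj : Carrier → Carrier → Set (c ⊔ ℓ)
  PaleyAdj u v = IsNonzeroSquare (u + (- v))

  record Colouring (n : ℕ) : Set (c ⊔ ℓ) where
    field
      colour      : Carrier → Fin n
      colour-cong : ∀ u v → u ≈ v → colour u ≡ colour v
      proper      : ∀ u v → PaleyAdj u v → colour u ≢ colour v
  open Colouring public

  Orthogonal : {n : ℕ} → Colouring n → Colouring n → Set (c ⊔ ℓ)
  Orthogonal f g = ∀ u v → ¬ (u ≈ v) → colour f u ≡ colour f v → colour g u ≢ colour g v

  OrthColouring : (k n : ℕ) → Set (c ⊔ ℓ)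
  OrthColouring k n =
    Σ (Fin k → Colouring n) λ cs → ∀ i j → i ≢ j → Orthogonal (cs i) (cs j)

  OχEq : (k n : ℕ) → Set (c ⊔ ℓ)
  OχEq k n = OrthColouring k n × (∀ m → m Data.Nat.< n → ¬ OrthColouring k m)

-- Write n = p^r = 1 + 2h. For b ≠ 0 the map u ↦ (bu)^n − bu is additive by Frobenius, its kernel is a line b⁻¹ 𝔽ₙ,
-- and its values are roots of z^n + z because z^(n²) = z. It is therefore a colouring with at most n colours.
-- Put e = h·2·(h+1) = (n²−1)/2. The colouring is proper when b^e ≠ 1, since nonzero w with (bw)^(n−1) = 1 has
-- (bw)^e = 1 whereas w^e = 1 for squares; the colourings of b and b′ are orthogonal when b^(n−1) ≠ b′^(n−1).
-- Counting roots of polynomials yields h + 1 such b. Conversely, two orthogonal colourings with m colours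
-- embed the field into pairs of colours, so n² ≤ m².
module Submission where

open import Defs
open import Level using (Level; _⊔_)
import Data.Nat as ℕ
import Data.Nat.Properties as ℕ
open import Data.Nat using (ℕ; zero; suc; z≤n; s≤s; NonZero)
open import Data.Nat.Combinatorics using (_C_; nCn≡1)
open import Data.Nat.Divisibility using (_∣_; divides)
open import Data.Nat.DivMod using (m*n/n≡m)
open import Data.Nat.Primality using (Prime; prime⇒nonZero)
open import Data.Fin as Fin using (Fin; zero; suc; toℕ; fromℕ; inject₁; inject≤; combine; punchIn)
import Data.Fin.Properties as Fin
import Data.Fin.Permutation as Perm
open import Data.Vec.Functional as Vector using (Vector)
open import Data.List as List using (List; []; _∷_; length; filter)
import Data.List.Properties as List
open import Data.List.Relation.Unary.All as All using (All; []; _∷_)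
import Data.List.Relation.Unary.All.Properties as All
open import Data.List.Relation.Unary.AllPairs using ([]; _∷_)
open import Data.List.Relation.Unary.Any as Any using (here; there)
import Data.List.Relation.Unary.Unique.Setoid as UniqueSetoid
import Data.List.Relation.Unary.Unique.Setoid.Properties as Unique
import Data.List.Membership.Setoid as MembershipSetoid
import Data.List.Membership.Setoid.Properties as Membership
open import Data.List.Relation.Ternary.Interleaving.Properties using (interleave-length)
import Data.List.Relation.Ternary.Interleaving.Setoid.Properties as Interleaving
open import Data.Product using (∃; _×_; _,_; proj₁; proj₂)
open import Data.Sum using (inj₁; inj₂)
open import Function using (_∘_; id)
open import Relation.Nullary using (¬_; Dec; yes; no; contradiction)
open import Relation.Nullary.Decidable using (¬?; map′)
open import Relation.Unary using (Decidable)
open import Relation.Binary.PropositionalEquality as ≡ using (_≡_; _≢_)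
open import Algebra.Bundles using (CommutativeMonoid; CommutativeRing)
import Algebra.Properties.CommutativeMonoid.Sum as Sum

-- Divisibility by a prime, and odd prime powers

module Arithmetic where

  open import Data.Nat using (_+_; _*_; _^_; _∸_; _/_; _%_; _!; _<_; _≤_; _≥_)
  open import Data.Nat.Combinatorics using (nCk≡n!/k![n-k]!; [n∸k]!k!∣n!)
  open import Data.Nat.Divisibility using (m∣m*n; m%n≡0⇒n∣m; ∣1⇒≡1; ∣⇒≤)
  open import Data.Nat.DivMod using (m≡m%n+[m/n]*n; m%n<n; m/n*n≡m)
  open import Data.Nat.Solver using (module +-*-Solver)
  open import Data.Nat.Primality using (euclidsLemma; prime⇒nonTrivial; prime⇒irreducible; prime[2])

  module _ {p} (p-prime : Prime p) where

    -- By Euclid's lemma `p` would divide one of the factors of `k !`, but these all lie between 1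
    -- and `k`.
    prime∤! : ∀ {k} → k < p → ¬ (p ∣ k !)
    prime∤! {zero}  _ p∣1 = contradiction (∣1⇒≡1 p∣1) (ℕ.nonTrivial⇒≢1 {{prime⇒nonTrivial p-prime}})
    prime∤! {suc k} k<p p∣k! with euclidsLemma (suc k) (k !) p-prime p∣k!
    ... | inj₁ p∣1+k = ℕ.<⇒≱ k<p (∣⇒≤ p∣1+k)
    ... | inj₂ p∣k!′ = prime∤! (ℕ.<-trans (ℕ.n<1+n k) k<p) p∣k!′

    -- `p` divides `p !`, the product of this coefficient with `k !` and `(p ∸ k) !`. Both
    -- factorials have arguments below `p`, the second because `0 < k`.
    prime∣C : ∀ {k} → 0 < k → k < p → p ∣ p C k
    prime∣C {k} 0<k k<p with euclidsLemma (p C k) (k ! * (p ∸ k) !) p-prime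
        (≡.subst (p ∣_) (≡.sym p!) (p∣p! (ℕ.≤-<-trans z≤n k<p)))
      where
      instance _ = k ℕ.!* (p ∸ k) !≢0
      p! : (p C k) * (k ! * (p ∸ k) !) ≡ p !
      p! = ≡.trans (≡.cong (_* (k ! * (p ∸ k) !)) (nCk≡n!/k![n-k]! (ℕ.<⇒≤ k<p)))
                   (m/n*n≡m (≡.subst (_∣ p !) (ℕ.*-comm ((p ∸ k) !) (k !)) ([n∸k]!k!∣n! (ℕ.<⇒≤ k<p))))
      p∣p! : ∀ {m} → 0 < m → m ∣ m !
      p∣p! {suc m} _ = m∣m*n (m !)
    ... | inj₁ p∣C = p∣C
    ... | inj₂ p∣k!* with euclidsLemma (k !) ((p ∸ k) !) p-prime p∣k!*
    ...   | inj₁ p∣k! = contradiction p∣k! (prime∤! k<p)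
    ...   | inj₂ p∣[p∸k]! = contradiction p∣[p∸k]! (prime∤! (ℕ.∸-monoʳ-< 0<k (ℕ.<⇒≤ k<p)))

    prime∣^⇒prime∣ : ∀ m k → p ∣ m ^ k → p ∣ m
    prime∣^⇒prime∣ m zero    p∣1 = contradiction (∣1⇒≡1 p∣1) (ℕ.nonTrivial⇒≢1 {{prime⇒nonTrivial p-prime}})
    prime∣^⇒prime∣ m (suc k) p∣mᵏ with euclidsLemma m (m ^ k) p-prime p∣mᵏ
    ... | inj₁ p∣m = p∣m
    ... | inj₂ p∣mᵏ′ = prime∣^⇒prime∣ m k p∣mᵏ′

  odd⇒1+*2 : ∀ n → ¬ (2 ∣ n) → n ≡ 1 + (n / 2) * 2
  odd⇒1+*2 n 2∤n with n % 2 in eq | m≡m%n+[m/n]*n n 2 | m%n<n n 2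
  ... | zero        | _  | _ = contradiction (m%n≡0⇒n∣m n 2 eq) 2∤n
  ... | suc zero    | n≡ | _ = n≡
  ... | suc (suc _) | _  | s≤s (s≤s ())

  oddPrimePower : ∀ {p r} → Prime p → p ≢ 2 → r ≥ 1 → ∃ λ h → 1 ≤ h × p ^ r ≡ 1 + h * 2
  oddPrimePower {p} {r@(suc r′)} p-prime p≢2 _ = h , ℕ.n≢0⇒n>0 h≢0 , pʳ≡
    where
    2∤p : ¬ (2 ∣ p)
    2∤p 2∣p with prime⇒irreducible p-prime 2∣p
    ... | inj₂ 2≡p = p≢2 (≡.sym 2≡p)
    h = (p ^ r) / 2
    pʳ≡ : p ^ r ≡ 1 + h * 2
    pʳ≡ = odd⇒1+*2 (p ^ r) (2∤p ∘ prime∣^⇒prime∣ prime[2] p r)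
    h≢0 : h ≢ 0
    -- With `h` zero the power would be 1, yet `p` divides it because the exponent is positive.
    h≢0 h≡0 = ℕ.nonTrivial⇒≢1 {{prime⇒nonTrivial p-prime}}
      (∣1⇒≡1 (≡.subst (p ∣_) (≡.trans pʳ≡ (≡.cong (λ k → 1 + k * 2) h≡0)) (m∣m*n (p ^ r′))))

  -- For odd n, half of n² - 1 is n - 1 times (n + 1)/2, which exhibits `e` as a multiple of n - 1.
  [1+2h]²≡1+e+e : ∀ h → let e = h * 2 * suc h in (1 + h * 2) * (1 + h * 2) ≡ 1 + (e + e)
  [1+2h]²≡1+e+e = solve 1 (λ h → let e = h :* con 2 :* (con 1 :+ h) in
    (con 1 :+ h :* con 2) :* (con 1 :+ h :* con 2) := con 1 :+ (e :+ e)) ≡.refl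
    where open +-*-Solver

module _ {c ℓ} (M : CommutativeMonoid c ℓ) where

  open CommutativeMonoid M
  open Sum M
  open import Algebra.Properties.Monoid.Mult monoid using () renaming (_×_ to _ₙ×_)

  -- Applied to products in the proof of Fermat's theorem: the exceptional entry sits at the zero of
  -- the field, and the count `pred m` becomes the exponent `pred q`.
  sum-constantExcept : ∀ {m} (t : Vector Carrier m) i {a} → t i ≈ ε →
                       (∀ j → j ≢ i → t j ≈ a) → sum t ≈ ℕ.pred m ₙ× a
  sum-constantExcept {suc m} t i tᵢ≈ε t≈a = trans (sum-remove t) (trans (∙-congʳ tᵢ≈ε) (trans (identityˡ _)
    (trans (sum-cong-≋ (λ j → t≈a (punchIn i j) (Fin.punchInᵢ≢i i j))) (sum-replicate m))))

-- Equality and cancellation in a finite field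

module FiniteFieldTheory {c ℓ q} (F : FiniteField c ℓ q) where

  open FiniteField F hiding (zero)
  open import Algebra.Properties.CommutativeSemiring.Exp commutativeSemiring public
  open import Algebra.Properties.Semiring.Mult semiring using (×-congʳ; ×-assoc-*; ×1-homo-*; ×-homo-1)
    renaming (_×_ to _ₙ×_)
  open import Algebra.Properties.AbelianGroup +-abelianGroup using (identityʳ-unique; //-rightDividesˡ)
  import Algebra.Properties.CommutativeSemiring.Binomial commutativeSemiring as Binomial
  open import Algebra.Properties.CommutativeMonoid.Sum +-commutativeMonoid
    using (sum; sum-cong-≋; sum-init-last; sum-replicate; sum-replicate-zero; ∑-distrib-+)
  module ∏ = Sum *-commutativeMonoid
  open import Algebra.Solver.Ring.NaturalCoefficients.Default commutativeSemiring using (solve; _:=_; _:+_; _:*_)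
  open import Relation.Binary.Reasoning.Setoid setoid
  open UniqueSetoid setoid using (Unique)
  open MembershipSetoid setoid using (_∈_)

  index : Carrier → Fin q
  index x = proj₁ (enum-surjective x)

  enum-index : ∀ x → enum (index x) ≈ x
  enum-index x = proj₂ (enum-surjective x)

  index-cong : ∀ {x y} → x ≈ y → index x ≡ index y
  index-cong x≈y = enum-injective _ _ (trans (enum-index _) (trans x≈y (sym (enum-index _))))

  index-enum : ∀ i → index (enum i) ≡ i
  index-enum i = enum-injective _ _ (enum-index _)

  -- `enum` identifies the carrier modulo `≈` with `Fin q`, where equality is decidable.
  _≈?_ : ∀ x y → Dec (x ≈ y)
  x ≈? y = map′ (λ ix≡iy → trans (sym (enum-index x)) (trans (reflexive (≡.cong enum ix≡iy)) (enum-index y)))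
                index-cong (index x Fin.≟ index y)

  *-cancelʳ : ∀ {x y} z → ¬ (z ≈ 0#) → x * z ≈ y * z → x ≈ y
  *-cancelʳ {x} {y} z z≉0 xz≈yz = begin
    x             ≈⟨ *-identityʳ x ⟨
    x * 1#        ≈⟨ *-congˡ zz⁻¹≈1 ⟨
    x * (z * z⁻¹) ≈⟨ *-assoc x z z⁻¹ ⟨
    x * z * z⁻¹   ≈⟨ *-congʳ xz≈yz ⟩
    y * z * z⁻¹   ≈⟨ *-assoc y z z⁻¹ ⟩
    y * (z * z⁻¹) ≈⟨ *-congˡ zz⁻¹≈1 ⟩
    y * 1#        ≈⟨ *-identityʳ y ⟩
    y             ∎
    where
    z⁻¹ = proj₁ (inverse z z≉0)
    zz⁻¹≈1 = proj₂ (inverse z z≉0)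

  *-cancelˡ : ∀ {x y} z → ¬ (z ≈ 0#) → z * x ≈ z * y → x ≈ y
  *-cancelˡ z z≉0 zx≈zy = *-cancelʳ z z≉0 (trans (*-comm _ z) (trans zx≈zy (*-comm z _)))

  ≉0-* : ∀ {x y} → ¬ (x ≈ 0#) → ¬ (y ≈ 0#) → ¬ (x * y ≈ 0#)
  ≉0-* {x} {y} x≉0 y≉0 xy≈0 = y≉0 (*-cancelˡ x x≉0 (trans xy≈0 (sym (zeroʳ x))))

  ≉0-*ˡ⁻ : ∀ {x y} → ¬ (x * y ≈ 0#) → ¬ (x ≈ 0#)
  ≉0-*ˡ⁻ {y = y} xy≉0 x≈0 = xy≉0 (trans (*-congʳ x≈0) (zeroˡ y))

  ≉0-*ʳ⁻ : ∀ {x y} → ¬ (x * y ≈ 0#) → ¬ (y ≈ 0#)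
  ≉0-*ʳ⁻ {x} xy≉0 y≈0 = xy≉0 (trans (*-congˡ y≈0) (zeroʳ x))

  -‿≉0 : ∀ {x y} → ¬ (x ≈ y) → ¬ (x - y ≈ 0#)
  -‿≉0 {x} {y} x≉y x-y≈0 = x≉y (trans (sym (//-rightDividesˡ y x)) (trans (+-congʳ x-y≈0) (+-identityˡ y)))

  -‿≉0⁻ : ∀ {x y} → ¬ (x - y ≈ 0#) → ¬ (x ≈ y)
  -‿≉0⁻ {x} {y} x-y≉0 x≈y = x-y≉0 (trans (+-congʳ x≈y) (-‿inverseʳ y))

  1^ : ∀ k → 1# ^ k ≈ 1#
  1^ zero    = refl
  1^ (suc k) = trans (*-identityˡ _) (1^ k)

  -- Sums and products over all elements, and Fermat's little theorem

  module _ (σ σ⁻¹ : Carrier → Carrier)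
           (σ-cong : ∀ {x y} → x ≈ y → σ x ≈ σ y) (σ⁻¹-cong : ∀ {x y} → x ≈ y → σ⁻¹ x ≈ σ⁻¹ y)
           (σσ⁻¹ : ∀ x → σ (σ⁻¹ x) ≈ x) (σ⁻¹σ : ∀ x → σ⁻¹ (σ x) ≈ x) where

    -- Moves a bijection of the field to the indices, so that sums and products over `enum` can be
    -- reindexed along it.
    enumPermutation : Perm.Permutation q q
    enumPermutation = Perm.permutation (index ∘ σ ∘ enum) (index ∘ σ⁻¹ ∘ enum)
      (λ i → ≡.trans (index-cong (trans (σ-cong (enum-index _)) (σσ⁻¹ (enum i)))) (index-enum i))
      (λ i → ≡.trans (index-cong (trans (σ⁻¹-cong (enum-index _)) (σ⁻¹σ (enum i)))) (index-enum i))

  -- Translation by 1 permutes the field, so adding 1 to each of the `q` summands leaves the total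
  -- unchanged.
  q×1≈0 : q ₙ× 1# ≈ 0#
  q×1≈0 = identityʳ-unique (sum enum) _ (begin
    sum enum + q ₙ× 1#                    ≈⟨ +-congˡ (sum-replicate q) ⟨
    sum enum + sum (Vector.replicate q 1#) ≈⟨ ∑-distrib-+ enum _ ⟨
    sum (λ i → enum i + 1#)               ≈⟨ sum-cong-≋ (λ i → enum-index (enum i + 1#)) ⟨
    sum (enum ∘ index ∘ (_+ 1#) ∘ enum)   ≈⟨ ∑.sum-permute enum translation ⟨
    sum enum                              ∎)
    where
    module ∑ = Sum +-commutativeMonoid
    translation : Perm.Permutation q q
    translation = enumPermutation (_+ 1#) (_- 1#) +-congʳ +-congʳ
      (//-rightDividesˡ 1#) (λ x → trans (+-assoc x 1# _) (trans (+-congˡ (-‿inverseʳ 1#)) (+-identityʳ x)))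

  -- Multiplication by a permutes the nonzero elements; replacing 0 by 1 in the product over the
  -- field turns it into a nonzero product over all of Fin q.
  fermat : ∀ {a} → ¬ (a ≈ 0#) → a ^ ℕ.pred q ≈ 1#
  fermat {a} a≉0 = trans (sym ∏ρ≈a^) (*-cancelʳ (∏.sum (κ ∘ enum)) (∏≉0 _ (λ i → κ≉0 (enum i))) (begin
    ∏.sum (ρ ∘ enum) * ∏.sum (κ ∘ enum)     ≈⟨ ∏.∑-distrib-+ (ρ ∘ enum) (κ ∘ enum) ⟨
    ∏.sum (λ i → ρ (enum i) * κ (enum i))   ≈⟨ ∏.sum-cong-≋ (λ i → trans (κ-cong (enum-index _)) (κ[ax] (enum i))) ⟨
    ∏.sum (κ ∘ enum ∘ index ∘ (a *_) ∘ enum) ≈⟨ ∏.sum-permute (κ ∘ enum) dilation ⟨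
    ∏.sum (κ ∘ enum)                        ≈⟨ *-identityˡ _ ⟨
    1# * ∏.sum (κ ∘ enum)                   ∎))
    where
    a⁻¹ = proj₁ (inverse a a≉0)
    aa⁻¹≈1 = proj₂ (inverse a a≉0)

    ifZero : Carrier → Carrier → Carrier → Carrier
    ifZero x y z with x ≈? 0#
    ... | yes _ = y
    ... | no  _ = z

    ifZero-yes : ∀ {x y z} → x ≈ 0# → ifZero x y z ≈ y
    ifZero-yes {x} x≈0 with x ≈? 0#
    ... | yes _  = refl
    ... | no x≉0 = contradiction x≈0 x≉0

    ifZero-no : ∀ {x y z} → ¬ (x ≈ 0#) → ifZero x y z ≈ z
    ifZero-no {x} x≉0 with x ≈? 0#
    ... | yes x≈0 = contradiction x≈0 x≉0
    ... | no _    = refl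

    κ ρ : Carrier → Carrier
    κ x = ifZero x 1# x
    ρ x = ifZero x 1# a

    κ≉0 : ∀ x → ¬ (κ x ≈ 0#)
    κ≉0 x with x ≈? 0#
    ... | yes _  = 1≉0
    ... | no x≉0 = x≉0

    κ-cong : ∀ {x y} → x ≈ y → κ x ≈ κ y
    κ-cong {x} {y} x≈y with y ≈? 0#
    ... | yes y≈0 = ifZero-yes (trans x≈y y≈0)
    ... | no y≉0  = trans (ifZero-no (λ x≈0 → y≉0 (trans (sym x≈y) x≈0))) x≈y

    κ[ax] : ∀ x → κ (a * x) ≈ ρ x * κ x
    κ[ax] x with x ≈? 0#
    ... | yes x≈0 = trans (ifZero-yes (trans (*-congˡ x≈0) (zeroʳ a))) (sym (*-identityˡ 1#))
    ... | no x≉0  = ifZero-no (≉0-* a≉0 x≉0)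

    ∏≉0 : ∀ {m} (t : Vector Carrier m) → (∀ i → ¬ (t i ≈ 0#)) → ¬ (∏.sum t ≈ 0#)
    ∏≉0 {zero}  t t≉0 = 1≉0
    ∏≉0 {suc m} t t≉0 = ≉0-* (t≉0 zero) (∏≉0 (t ∘ suc) (t≉0 ∘ suc))

    ∏ρ≈a^ : ∏.sum (ρ ∘ enum) ≈ a ^ ℕ.pred q
    ∏ρ≈a^ = sum-constantExcept *-commutativeMonoid (ρ ∘ enum) (index 0#)
      (ifZero-yes (enum-index 0#))
      (λ j j≢i₀ → ifZero-no (λ enumⱼ≈0 → j≢i₀ (enum-injective _ _ (trans enumⱼ≈0 (sym (enum-index 0#))))))

    dilation : Perm.Permutation q q
    dilation = enumPermutation (a *_) (a⁻¹ *_) *-congˡ *-congˡ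
      (λ x → trans (sym (*-assoc a a⁻¹ x)) (trans (*-congʳ aa⁻¹≈1) (*-identityˡ x)))
      (λ x → trans (sym (*-assoc a⁻¹ a x)) (trans (*-congʳ (trans (*-comm a⁻¹ a) aa⁻¹≈1)) (*-identityˡ x)))

  fermat′ : ∀ a → a ^ q ≈ a
  fermat′ a with a ≈? 0#
  -- `index 0#` inhabits `Fin q`, so `q` is positive; both cases rely on this.
  ... | no a≉0  = trans (^-congʳ a (≡.sym (1+pred (index 0#))))
                        (trans (*-congˡ (fermat a≉0)) (*-identityʳ a))
    where
    1+pred : ∀ {m} → Fin m → suc (ℕ.pred m) ≡ m
    1+pred {suc m} _ = ≡.refl
  ... | yes a≈0 = trans (0^ (index 0#)) (sym a≈0)
    where
    0^ : ∀ {m} → Fin m → a ^ m ≈ 0#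
    0^ {suc m} _ = trans (*-congʳ a≈0) (zeroˡ _)

  -- Characteristic and the Frobenius map

  AdditivePower : ℕ → Set (c ⊔ ℓ)
  AdditivePower n = ∀ x y → (x + y) ^ n ≈ x ^ n + y ^ n

  module _ {p} (p-prime : Prime p) (r : ℕ) (q≡p^r : q ≡ p ℕ.^ r) where

    -- The multiple `q ₙ× 1#`, which is zero, is a product of `r` factors `p ₙ× 1#`, and a field has
    -- no zero divisors.
    characteristic : p ₙ× 1# ≈ 0#
    characteristic = p^k×1≈0⇒p×1≈0 r (trans (reflexive (≡.cong (_ₙ× 1#) (≡.sym q≡p^r))) q×1≈0)
      where
      p^k×1≈0⇒p×1≈0 : ∀ k → (p ℕ.^ k) ₙ× 1# ≈ 0# → p ₙ× 1# ≈ 0#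
      p^k×1≈0⇒p×1≈0 zero    1≈0 = contradiction (trans (sym (×-homo-1 1#)) 1≈0) 1≉0
      p^k×1≈0⇒p×1≈0 (suc k) p^k×1≈0 with (p ₙ× 1#) ≈? 0#
      ... | yes p×1≈0 = p×1≈0
      ... | no  p×1≉0 = p^k×1≈0⇒p×1≈0 k (*-cancelˡ (p ₙ× 1#) p×1≉0
        (trans (sym (×1-homo-* p (p ℕ.^ k))) (trans p^k×1≈0 (sym (zeroʳ _)))))

    p∣m⇒m×x≈0 : ∀ {m} → p ∣ m → ∀ x → m ₙ× x ≈ 0#
    p∣m⇒m×x≈0 (divides d ≡.refl) x = begin
      (d ℕ.* p) ₙ× x              ≈⟨ ×-congʳ (d ℕ.* p) (*-identityˡ x) ⟨
      (d ℕ.* p) ₙ× (1# * x)       ≈⟨ ×-assoc-* (d ℕ.* p) 1# x ⟨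
      ((d ℕ.* p) ₙ× 1#) * x       ≈⟨ *-congʳ (×1-homo-* d p) ⟩
      (d ₙ× 1#) * (p ₙ× 1#) * x   ≈⟨ *-congʳ (*-congˡ characteristic) ⟩
      (d ₙ× 1#) * 0# * x          ≈⟨ *-congʳ (zeroʳ _) ⟩
      0# * x                      ≈⟨ zeroˡ x ⟩
      0#                          ∎

    -- The inner binomial coefficients are multiples of `p` and vanish in the field, so only the two
    -- outer terms survive.
    frobenius₁ : AdditivePower p
    -- Writing `p` as `suc m` exposes the first and the last term of the binomial sum.
    frobenius₁ x y = ≡.subst (λ k → (x + y) ^ k ≈ x ^ k + y ^ k) 1+m≡p (begin
      (x + y) ^ suc m                                           ≈⟨ Binomial.theorem (suc m) x y ⟩
      t zero + sum (t ∘ suc)                                    ≈⟨ +-cong first (sum-init-last (t ∘ suc)) ⟩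
      y ^ suc m + (sum (t ∘ suc ∘ inject₁) + t (suc (fromℕ m))) ≈⟨ +-congˡ (+-cong middle last) ⟩
      y ^ suc m + (0# + x ^ suc m)                              ≈⟨ +-congˡ (+-identityˡ _) ⟩
      y ^ suc m + x ^ suc m                                     ≈⟨ +-comm _ _ ⟩
      x ^ suc m + y ^ suc m                                     ∎)
      where
      m = ℕ.pred p

      1+m≡p : suc m ≡ p
      1+m≡p = ℕ.suc-pred p {{prime⇒nonZero p-prime}}

      t = Binomial.binomialTerm x y (suc m)

      first : t zero ≈ y ^ suc m
      first = trans (×-homo-1 _) (*-identityˡ _)

      p∣C : ∀ i → p ∣ suc m C suc (toℕ (inject₁ i))
      p∣C i = ≡.subst (λ n → p ∣ n C suc (toℕ (inject₁ i))) (≡.sym 1+m≡p)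
        (Arithmetic.prime∣C p-prime (s≤s z≤n)
          (≡.subst₂ ℕ._<_ (≡.cong suc (≡.sym (Fin.toℕ-inject₁ i))) 1+m≡p (s≤s (Fin.toℕ<n i))))

      middle : sum (t ∘ suc ∘ inject₁) ≈ 0#
      middle = trans (sum-cong-≋ (λ i → p∣m⇒m×x≈0 (p∣C i) _)) (sum-replicate-zero m)

      last : t (suc (fromℕ m)) ≈ x ^ suc m
      last rewrite Fin.toℕ-fromℕ m | nCn≡1 (suc m) | ℕ.n∸n≡0 m = trans (×-homo-1 _) (*-identityʳ _)

    -- Iterates the `p`-th power map. The exponent `k` is independent of `r`, because the colourings
    -- take the power given by the square root of `q`.
    frobenius : ∀ k → AdditivePower (p ℕ.^ k)
    frobenius zero    x y = trans (*-identityʳ _) (sym (+-cong (*-identityʳ x) (*-identityʳ y)))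
    frobenius (suc k) x y = begin
      (x + y) ^ (p ℕ.* p ℕ.^ k)                            ≈⟨ ^-assocʳ (x + y) p _ ⟨
      ((x + y) ^ p) ^ (p ℕ.^ k)                            ≈⟨ ^-congˡ (p ℕ.^ k) (frobenius₁ x y) ⟩
      (x ^ p + y ^ p) ^ (p ℕ.^ k)                          ≈⟨ frobenius k (x ^ p) (y ^ p) ⟩
      (x ^ p) ^ (p ℕ.^ k) + (y ^ p) ^ (p ℕ.^ k)            ≈⟨ +-cong (^-assocʳ x p _) (^-assocʳ y p _) ⟩
      x ^ (p ℕ.* p ℕ.^ k) + y ^ (p ℕ.* p ℕ.^ k)            ∎

  -- Monic polynomials and bounds on the number of roots

  -- A polynomial is represented by its function together with a Horner scheme ending in the leading
  -- coefficient 1, so that degree arguments become inductions on the scheme.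
  data Monic : ℕ → (Carrier → Carrier) → Set (c ⊔ ℓ) where
    constant : ∀ {f} → (∀ x → f x ≈ 1#) → Monic 0 f
    horner   : ∀ {d f g} a → Monic d g → (∀ x → f x ≈ a + x * g x) → Monic (suc d) f

  monic-^ : ∀ d → Monic d (_^ d)
  monic-^ zero    = constant (λ _ → refl)
  monic-^ (suc d) = horner 0# (monic-^ d) (λ x → sym (+-identityˡ _))

  monic-+constant : ∀ {d f} k → Monic (suc d) f → Monic (suc d) (λ x → f x + k)
  monic-+constant k (horner a mg f≈) =
    horner (a + k) mg (λ x → trans (+-congʳ (f≈ x)) (solve 3 (λ a b k → a :+ b :+ k := a :+ k :+ b) refl a _ k))

  -- f x − f a = (x − a) g x, with both sides moved so that no subtraction occurs.
  factorTheorem : ∀ {d f} → Monic (suc d) f → ∀ a →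
                  ∃ λ g → Monic d g × (∀ x → f x + a * g x ≈ f a + x * g x)
  factorTheorem {zero} {f} (horner {g = f₁} b (constant f₁≈1) f≈) a =
    (λ _ → 1#) , constant (λ _ → refl) , λ x → begin
      f x + a * 1#         ≈⟨ +-congʳ (trans (f≈ x) (+-congˡ (*-congˡ (f₁≈1 x)))) ⟩
      b + x * 1# + a * 1#  ≈⟨ solve 3 (λ b x a → b :+ x :+ a := b :+ a :+ x) refl b _ _ ⟩
      b + a * 1# + x * 1#  ≈⟨ +-congʳ (trans (f≈ a) (+-congˡ (*-congˡ (f₁≈1 a)))) ⟨
      f a + x * 1#         ∎
  factorTheorem {suc d} {f} (horner {g = f₁} b mf₁ f≈) a with factorTheorem mf₁ a
  -- The cofactor comes from x f₁(x) - a f₁(a) = (x - a) f₁(a) + x (f₁(x) - f₁(a)).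
  ... | h , mh , f₁≈ = (λ x → f₁ a + x * h x) , horner (f₁ a) mh (λ _ → refl) , λ x → begin
      f x + a * (f₁ a + x * h x)          ≈⟨ +-congʳ (f≈ x) ⟩
      b + x * f₁ x + a * (f₁ a + x * h x) ≈⟨ solve 6 (λ b x f₁x a f₁a hx →
          b :+ x :* f₁x :+ a :* (f₁a :+ x :* hx) := b :+ a :* f₁a :+ x :* (f₁x :+ a :* hx)) refl b x _ a _ _ ⟩
      b + a * f₁ a + x * (f₁ x + a * h x) ≈⟨ +-cong (sym (f≈ a)) (*-congˡ (f₁≈ x)) ⟩
      f a + x * (f₁ a + x * h x)          ∎

  -- A bound on duplicate-free lists makes sense for any function, so bounds for factors can be
  -- combined without a Horner scheme of their product.
  AtMostRoots : ℕ → (Carrier → Carrier) → Set (c ⊔ ℓ)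
  AtMostRoots d f = ∀ {xs} → Unique xs → All (λ x → f x ≈ 0#) xs → length xs ℕ.≤ d

  -- Splitting off the first listed root lowers the degree by one, and every other listed root,
  -- being different from it, is a root of the cofactor.
  monic⇒atMostRoots : ∀ {d f} → Monic d f → AtMostRoots d f
  monic⇒atMostRoots mf                [] [] = z≤n
  monic⇒atMostRoots (constant f≈1)    (_ ∷ _) (fx≈0 ∷ _) = contradiction (trans (sym (f≈1 _)) fx≈0) 1≉0
  monic⇒atMostRoots {f = f} mf@(horner _ _ _) {a ∷ _} (a∉xs ∷ xs!) (fa≈0 ∷ fxs≈0) with factorTheorem mf a
  ... | g , mg , f≈ = s≤s (monic⇒atMostRoots mg xs! (All.zipWith root (a∉xs , fxs≈0)))
    where
    root : ∀ {x} → ¬ (a ≈ x) × f x ≈ 0# → g x ≈ 0#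
    root {x} (a≉x , fx≈0) with g x ≈? 0#
    ... | yes gx≈0 = gx≈0
    ... | no gx≉0  = contradiction (*-cancelʳ (g x) gx≉0 (begin
      a * g x        ≈⟨ trans (+-congʳ fx≈0) (+-identityˡ _) ⟨
      f x + a * g x  ≈⟨ f≈ x ⟩
      f a + x * g x  ≈⟨ trans (+-congʳ fa≈0) (+-identityˡ _) ⟩
      x * g x        ∎)) a≉x

  -- The list splits into the roots of `f` and the rest, and the rest must be roots of `g`.
  atMostRoots-* : ∀ {d e f g} → AtMostRoots d f → AtMostRoots e g → AtMostRoots (d ℕ.+ e) (λ x → f x * g x)
  atMostRoots-* {d} {e} {f} {g} df eg {xs} xs! fg≈0 =
    ≡.subst (ℕ._≤ d ℕ.+ e) (≡.sym (interleave-length (Interleaving.filter⁺ setoid f≈0? xs)))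
      (ℕ.+-mono-≤ (df (Unique.filter⁺ setoid f≈0? xs!) (All.all-filter f≈0? xs))
                  (eg (Unique.filter⁺ setoid (¬? ∘ f≈0?) xs!)
                      (All.zipWith cofactor (All.all-filter (¬? ∘ f≈0?) xs , All.filter⁺ (¬? ∘ f≈0?) fg≈0))))
    where
    f≈0? : Decidable (λ x → f x ≈ 0#)
    f≈0? x = f x ≈? 0#
    cofactor : ∀ {x} → ¬ (f x ≈ 0#) × f x * g x ≈ 0# → g x ≈ 0#
    cofactor {x} (fx≉0 , fgx≈0) = *-cancelˡ (f x) fx≉0 (trans fgx≈0 (sym (zeroʳ _)))

  atMostRoots-^-constant : ∀ d .{{_ : NonZero d}} k → AtMostRoots d (λ x → x ^ d - k)
  atMostRoots-^-constant (suc d) k = monic⇒atMostRoots (monic-+constant (- k) (monic-^ (suc d)))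

  -- Listing the elements and numbering the roots

  elements : List Carrier
  elements = List.tabulate enum

  elements-unique : Unique elements
  elements-unique = Unique.tabulate⁺ setoid (enum-injective _ _)

  ∈-elements : ∀ x → x ∈ elements
  ∈-elements x = Membership.∈-resp-≈ setoid (enum-index x) (Membership.∈-tabulate⁺ setoid (index x))

  -- Otherwise all `q` elements would form a list of roots longer than `d`. Decidability turns this
  -- refutation into a search.
  nonroot : ∀ {d f} → AtMostRoots d f → d ℕ.< q → ∃ λ x → ¬ (f x ≈ 0#)
  nonroot {d} {f} df d<q with Fin.¬∀⟶∃¬ q (λ i → f (enum i) ≈ 0#) (λ i → f (enum i) ≈? 0#)
    (λ f≈0 → ℕ.<⇒≱ d<q (≡.subst (ℕ._≤ d) (List.length-tabulate enum) (df elements-unique (All.tabulate⁺ f≈0))))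
  ... | i , fᵢ≉0 = enum i , fᵢ≉0

  -- Makes the number of a root independent of its representative and of the membership proof, so
  -- that colours respect `≈`.
  anyIndex-cong : ∀ {x y xs} → Unique xs → (x∈ : x ∈ xs) (y∈ : y ∈ xs) → x ≈ y → Any.index x∈ ≡ Any.index y∈
  anyIndex-cong _            (here _)    (here _)    _   = ≡.refl
  anyIndex-cong (x∉ ∷ _)     (here x≈)   (there y∈)  x≈y =
    contradiction (Membership.∈-resp-≈ setoid (trans (sym x≈y) x≈) y∈) (All.All¬⇒¬Any x∉)
  anyIndex-cong (y∉ ∷ _)     (there x∈)  (here y≈)   x≈y =
    contradiction (Membership.∈-resp-≈ setoid (trans x≈y y≈) x∈) (All.All¬⇒¬Any y∉)
  anyIndex-cong (_ ∷ xs!)    (there x∈)  (there y∈)  x≈y = ≡.cong suc (anyIndex-cong xs! x∈ y∈ x≈y)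

  module RootIndex {d f} (df : AtMostRoots d f) (f-cong : ∀ {x y} → x ≈ y → f x ≈ f y) where

    private
      f≈0? : Decidable (λ x → f x ≈ 0#)
      f≈0? x = f x ≈? 0#

      f≈0-resp : ∀ {x y} → x ≈ y → f x ≈ 0# → f y ≈ 0#
      f≈0-resp x≈y fx≈0 = trans (f-cong (sym x≈y)) fx≈0

      roots : List Carrier
      roots = filter f≈0? elements

      roots-unique : Unique roots
      roots-unique = Unique.filter⁺ setoid f≈0? elements-unique

      #roots≤d : length roots ℕ.≤ d
      #roots≤d = df roots-unique (All.all-filter f≈0? elements)

      ∈-roots : ∀ {x} → f x ≈ 0# → x ∈ roots
      ∈-roots {x} = Membership.∈-filter⁺ setoid f≈0? f≈0-resp (∈-elements x)

    rootIndex : ∀ {x} → f x ≈ 0# → Fin d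
    -- There may be fewer than `d` roots, so the position in the list is embedded into `Fin d`.
    rootIndex fx≈0 = inject≤ (Any.index (∈-roots fx≈0)) #roots≤d

    rootIndex-cong : ∀ {x y} (fx≈0 : f x ≈ 0#) (fy≈0 : f y ≈ 0#) → x ≈ y → rootIndex fx≈0 ≡ rootIndex fy≈0
    rootIndex-cong fx≈0 fy≈0 x≈y =
      ≡.cong (λ i → inject≤ i #roots≤d) (anyIndex-cong roots-unique (∈-roots fx≈0) (∈-roots fy≈0) x≈y)

    rootIndex-injective : ∀ {x y} (fx≈0 : f x ≈ 0#) (fy≈0 : f y ≈ 0#) → rootIndex fx≈0 ≡ rootIndex fy≈0 → x ≈ y
    rootIndex-injective fx≈0 fy≈0 eq = Membership.index-injective setoid (∈-roots fx≈0) (∈-roots fy≈0)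
      (Fin.inject≤-injective #roots≤d #roots≤d _ _ eq)

-- Colourings of the Paley graph by parallel lines

module PaleyColouring {c ℓ q} (F : FiniteField c ℓ q) (n h : ℕ)
  (1≤h : 1 ℕ.≤ h) (n≡1+2h : n ≡ 1 ℕ.+ h ℕ.* 2) (q≡n² : q ≡ n ℕ.* n)
  (frobenius : FiniteFieldTheory.AdditivePower F n) where

  open FiniteField F hiding (zero)
  open FiniteFieldTheory F hiding (frobenius)
  open import Algebra.Properties.AbelianGroup +-abelianGroup using (//-rightDividesˡ; //-rightDividesʳ)
  open import Algebra.Properties.Ring (CommutativeRing.ring commRing) using (x[y-z]≈xy-xz)
  open import Algebra.Solver.Ring.NaturalCoefficients.Default commutativeSemiring using (solve; _:=_; _:+_)
  open import Relation.Binary.Reasoning.Setoid setoid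

  -- `m` is n - 1. Keeping `e` as a multiple of `m` lets a relation between `m`-th powers be raised
  -- to one between `e`-th powers.
  m e : ℕ
  m = h ℕ.* 2
  e = m ℕ.* suc h

  private instance
    m-nonZero : NonZero m
    m-nonZero = ℕ.m*n≢0 h 2 {{ℕ.>-nonZero 1≤h}}

    e-nonZero : NonZero e
    e-nonZero = ℕ.m*n≢0 m (suc h)

  q≡1+e+e : q ≡ 1 ℕ.+ (e ℕ.+ e)
  q≡1+e+e = ≡.trans q≡n² (≡.trans (≡.cong (λ k → k ℕ.* k) n≡1+2h) (Arithmetic.[1+2h]²≡1+e+e h))

  frobenius⁻ : ∀ x y → (x - y) ^ n ≈ x ^ n - y ^ n
  frobenius⁻ x y = begin
    (x - y) ^ n                   ≈⟨ //-rightDividesʳ (y ^ n) _ ⟨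
    (x - y) ^ n + y ^ n - y ^ n   ≈⟨ +-congʳ (frobenius (x - y) y) ⟨
    ((x - y) + y) ^ n - y ^ n     ≈⟨ +-congʳ (^-congˡ n (//-rightDividesˡ y x)) ⟩
    x ^ n - y ^ n                 ∎

  φ : Carrier → Carrier
  φ x = x ^ n - x

  φ-cong : ∀ {x y} → x ≈ y → φ x ≈ φ y
  φ-cong x≈y = +-cong (^-congˡ n x≈y) (-‿cong x≈y)

  -- Since n² = q, the `n`-th power map interchanges `x ^ n` and `x`, and so changes the sign of
  -- `φ x`.
  φ-image : ∀ x → φ x ^ n + φ x ≈ 0#
  φ-image x = begin
    φ x ^ n + φ x                    ≈⟨ +-congʳ (frobenius⁻ (x ^ n) x) ⟩
    (x ^ n) ^ n - x ^ n + φ x        ≈⟨ +-congʳ (+-congʳ xⁿⁿ≈x) ⟩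
    x - x ^ n + (x ^ n - x)          ≈⟨ +-assoc _ _ _ ⟨
    x - x ^ n + x ^ n - x            ≈⟨ +-congʳ (//-rightDividesˡ (x ^ n) x) ⟩
    x - x                            ≈⟨ -‿inverseʳ x ⟩
    0#                               ∎
    where
    xⁿⁿ≈x : (x ^ n) ^ n ≈ x
    xⁿⁿ≈x = trans (^-assocʳ x n n) (trans (^-congʳ x (≡.sym q≡n²)) (fermat′ x))

  -- By additivity, equal values of `φ` mean that `φ` vanishes at the difference.
  φ-fibre : ∀ {x y} → φ x ≈ φ y → (x - y) ^ n ≈ x - y
  φ-fibre {x} {y} φx≈φy = begin
    (x - y) ^ n                  ≈⟨ frobenius⁻ x y ⟩
    x ^ n - y ^ n                ≈⟨ +-congʳ (//-rightDividesˡ x (x ^ n)) ⟨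
    φ x + x - y ^ n              ≈⟨ +-congʳ (+-congʳ φx≈φy) ⟩
    y ^ n - y + x - y ^ n        ≈⟨ solve 4 (λ a b c d → a :+ b :+ c :+ d := c :+ b :+ (a :+ d)) refl (y ^ n) (- y) x (- (y ^ n)) ⟩
    x - y + (y ^ n - y ^ n)      ≈⟨ +-congˡ (-‿inverseʳ (y ^ n)) ⟩
    x - y + 0#                   ≈⟨ +-identityʳ _ ⟩
    x - y                        ∎

  ^n≈id⇒^m≈1 : ∀ {x} → ¬ (x ≈ 0#) → x ^ n ≈ x → x ^ m ≈ 1#
  ^n≈id⇒^m≈1 {x} x≉0 xⁿ≈x = *-cancelˡ x x≉0
    (trans (^-congʳ x (≡.sym n≡1+2h)) (trans xⁿ≈x (sym (*-identityʳ x))))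

  ^n+id-atMostRoots : AtMostRoots n (λ z → z ^ n + z)
  ^n+id-atMostRoots = ≡.subst (λ k → AtMostRoots k (λ z → z ^ k + z)) (≡.sym n≡1+2h)
    (^+id-atMostRoots m)
    where
    ^+id-atMostRoots : ∀ d .{{_ : NonZero d}} → AtMostRoots (suc d) (λ z → z ^ suc d + z)
    -- Factoring out z leaves a power of z plus 1, which is monic of the right degree only for a
    -- positive exponent.
    ^+id-atMostRoots (suc d) = monic⇒atMostRoots (horner 0# (monic-+constant 1# (monic-^ (suc d))) (λ z →
      sym (trans (+-identityˡ _) (trans (distribˡ z _ 1#) (+-congˡ (*-identityʳ z))))))

  open RootIndex ^n+id-atMostRoots (λ x≈y → +-cong (^-congˡ n x≈y) x≈y)

  module _ (b : Carrier) where

    lineColour : Carrier → Fin n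
    lineColour u = rootIndex (φ-image (b * u))

    lineColour-cong : ∀ {u v} → u ≈ v → lineColour u ≡ lineColour v
    lineColour-cong u≈v = rootIndex-cong (φ-image _) (φ-image _) (φ-cong (*-congˡ u≈v))

    -- Equal colours put `b * (u - v)` among the fixed points of the `n`-th power map. The factor
    -- `b ^ m` is kept separate because both properness and orthogonality are read off from it.
    lineColour-fibre : ∀ {u v} → ¬ (b ≈ 0#) → ¬ (u ≈ v) → lineColour u ≡ lineColour v → b ^ m * (u - v) ^ m ≈ 1#
    lineColour-fibre {u} {v} b≉0 u≉v same = trans (sym (^-distrib-* b (u - v) m))
      (^n≈id⇒^m≈1 (≉0-* b≉0 (-‿≉0 u≉v)) (begin
        (b * (u - v)) ^ n      ≈⟨ ^-congˡ n (x[y-z]≈xy-xz b u v) ⟩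
        (b * u - b * v) ^ n    ≈⟨ φ-fibre (rootIndex-injective (φ-image (b * u)) (φ-image (b * v)) same) ⟩
        b * u - b * v          ≈⟨ x[y-z]≈xy-xz b u v ⟨
        b * (u - v)            ∎))

    lineColour-proper : ¬ (b ≈ 0#) → ¬ (b ^ e ≈ 1#) → ∀ u v → PaleyAdj F u v → lineColour u ≢ lineColour v
    lineColour-proper b≉0 bᵉ≉1 u v (w≉0 , y , y²≈w) same = bᵉ≉1 (begin
      b ^ e                           ≈⟨ *-identityʳ _ ⟨
      b ^ e * 1#                      ≈⟨ *-congˡ wᵉ≈1 ⟨
      b ^ e * w ^ e                   ≈⟨ *-cong (^-assocʳ b m (suc h)) (^-assocʳ w m (suc h)) ⟨
      (b ^ m) ^ suc h * (w ^ m) ^ suc h ≈⟨ ^-distrib-* (b ^ m) (w ^ m) (suc h) ⟨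
      (b ^ m * w ^ m) ^ suc h         ≈⟨ ^-congˡ (suc h) (lineColour-fibre b≉0 (-‿≉0⁻ w≉0) same) ⟩
      1# ^ suc h                      ≈⟨ 1^ (suc h) ⟩
      1#                              ∎)
      where
      w = u - v
      wᵉ≈1 : w ^ e ≈ 1#
      -- As 2e = q - 1, Fermat's theorem applies to the square root `y` of `w`.
      wᵉ≈1 = begin
        w ^ e          ≈⟨ ^-congˡ e y²≈w ⟨
        (y * y) ^ e    ≈⟨ ^-distrib-* y y e ⟩
        y ^ e * y ^ e  ≈⟨ ^-homo-* y e e ⟨
        y ^ (e ℕ.+ e)  ≈⟨ ^-congʳ y (≡.cong ℕ.pred q≡1+e+e) ⟨
        y ^ ℕ.pred q   ≈⟨ fermat (≉0-*ˡ⁻ (λ yy≈0 → w≉0 (trans (sym y²≈w) yy≈0))) ⟩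
        1#             ∎

  -- If both colours agreed, `b ^ m` and `b′ ^ m` would both be the inverse of `(u - v) ^ m`.
  lineColours-orthogonal : ∀ {b b′} → ¬ (b ≈ 0#) → ¬ (b′ ≈ 0#) → ¬ (b ^ m ≈ b′ ^ m) →
    ∀ u v → ¬ (u ≈ v) → lineColour b u ≡ lineColour b v → lineColour b′ u ≢ lineColour b′ v
  lineColours-orthogonal {b} {b′} b≉0 b′≉0 bᵐ≉b′ᵐ u v u≉v same same′ =
    bᵐ≉b′ᵐ (*-cancelʳ ((u - v) ^ m) (≉0-*ʳ⁻ {b ^ m} (λ ≈0 → 1≉0 (trans (sym bᵐwᵐ≈1) ≈0)))
      (trans bᵐwᵐ≈1 (sym (lineColour-fibre b′ b′≉0 u≉v same′))))
    where
    bᵐwᵐ≈1 = lineColour-fibre b b≉0 u≉v same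

  -- Choice of the directions

  avoiding : ∀ {j} → (Fin j → Carrier) → Carrier → Carrier
  avoiding {zero}  cs x = 1#
  avoiding {suc j} cs x = (x ^ m - cs zero) * avoiding (cs ∘ suc) x

  avoiding-atMostRoots : ∀ {j} (cs : Fin j → Carrier) → AtMostRoots (j ℕ.* m) (avoiding cs)
  avoiding-atMostRoots {zero}  cs = monic⇒atMostRoots (constant (λ _ → refl))
  avoiding-atMostRoots {suc j} cs =
    atMostRoots-* (atMostRoots-^-constant m (cs zero)) (avoiding-atMostRoots (cs ∘ suc))

  avoiding≉0 : ∀ {j} (cs : Fin j → Carrier) {x} → ¬ (avoiding cs x ≈ 0#) → ∀ i → ¬ (x ^ m ≈ cs i)
  avoiding≉0 cs ≉0 zero    = -‿≉0⁻ (≉0-*ˡ⁻ ≉0)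
  avoiding≉0 cs ≉0 (suc i) = avoiding≉0 (cs ∘ suc) (≉0-*ʳ⁻ ≉0) i

  record Directions (j : ℕ) : Set (c ⊔ ℓ) where
    field
      direction          : Fin j → Carrier
      direction≉0        : ∀ i → ¬ (direction i ≈ 0#)
      direction^e≉1      : ∀ i → ¬ (direction i ^ e ≈ 1#)
      direction^m-differ : ∀ i i′ → i ≢ i′ → ¬ (direction i ^ m ≈ direction i′ ^ m)
  open Directions

  -- Greedy choice: the elements unsuitable as a further direction are the roots of
  -- x (xᵉ − 1) ∏ᵢ (xᵐ − bᵢᵐ), whose degree 1 + e + j m is less than q while j ≤ h.
  directions : ∀ j → j ℕ.≤ suc h → Directions j
  directions zero    _ = record
    { direction = λ (); direction≉0 = λ (); direction^e≉1 = λ (); direction^m-differ = λ () }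
  directions (suc j) (s≤s j≤h) = record
    { direction          = λ { zero → b ; (suc i) → direction D i }
    ; direction≉0        = λ { zero → ≉0-*ˡ⁻ b-good ; (suc i) → direction≉0 D i }
    ; direction^e≉1      = λ { zero → -‿≉0⁻ (≉0-*ˡ⁻ (≉0-*ʳ⁻ b-good)) ; (suc i) → direction^e≉1 D i }
    ; direction^m-differ = λ
        { zero    zero     0≢0  → contradiction ≡.refl 0≢0
        ; zero    (suc i′) _    → b-new i′
        ; (suc i) zero     _    → b-new i ∘ sym
        ; (suc i) (suc i′) i≢i′ → direction^m-differ D i i′ (i≢i′ ∘ ≡.cong suc)
        }
    }
    where
    D = directions j (ℕ.m≤n⇒m≤1+n j≤h)

    id-atMostRoots : AtMostRoots 1 id
    id-atMostRoots = monic⇒atMostRoots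
      (horner 0# (constant (λ _ → refl)) (λ x → sym (trans (+-identityˡ _) (*-identityʳ x))))

    degree<q : 1 ℕ.+ (e ℕ.+ j ℕ.* m) ℕ.< q
    -- Cancelling `1 + e` from `q` leaves `j * m < e`, which holds because `e` is `m * suc h` and
    -- `j ≤ h`.
    degree<q = ≡.subst (1 ℕ.+ (e ℕ.+ j ℕ.* m) ℕ.<_) (≡.sym q≡1+e+e) (s≤s (ℕ.+-monoʳ-< e
      (ℕ.≤-<-trans (ℕ.*-monoˡ-≤ m j≤h) (≡.subst (h ℕ.* m ℕ.<_) (ℕ.*-comm (suc h) m) (ℕ.*-monoˡ-< m (ℕ.n<1+n h))))))

    new = nonroot (atMostRoots-* id-atMostRoots (atMostRoots-* (atMostRoots-^-constant e 1#)
      (avoiding-atMostRoots (λ i → direction D i ^ m)))) degree<q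
    b = proj₁ new
    b-good = proj₂ new

    b-new : ∀ i → ¬ (b ^ m ≈ direction D i ^ m)
    b-new = avoiding≉0 _ (≉0-*ʳ⁻ (≉0-*ʳ⁻ b-good))

  orthColouring : OrthColouring F (suc h) n
  orthColouring = colouring , λ i j i≢j →
    lineColours-orthogonal (direction≉0 D i) (direction≉0 D j) (direction^m-differ D i j i≢j)
    where
    D = directions (suc h) ℕ.≤-refl
    colouring : Fin (suc h) → Colouring F n
    colouring i = record
      { colour      = lineColour (direction D i)
      ; colour-cong = λ _ _ → lineColour-cong (direction D i)
      ; proper      = lineColour-proper (direction D i) (direction≉0 D i) (direction^e≉1 D i)
      }

-- The lower bound and the theorem

orthogonal⇒q≤n² : ∀ {c ℓ q n} (F : FiniteField c ℓ q) (f g : Colouring F n) → Orthogonal F f g → q ℕ.≤ n ℕ.* n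
orthogonal⇒q≤n² F f g f⊥g = ℕ.≮⇒≥ λ n²<q →
  -- `combine` encodes the pair of colours as one of `n * n` values; a collision between distinct
  -- elements contradicts orthogonality.
  let i , j , i<j , same = Fin.pigeonhole n²<q (λ i → combine (colour f (enum i)) (colour g (enum i)))
      sameᶠ , sameᵍ = Fin.combine-injective _ _ _ _ same
  in f⊥g (enum i) (enum j) (Fin.<⇒≢ i<j ∘ enum-injective i j) sameᶠ sameᵍ
  where open FiniteField F using (enum; enum-injective)

open import Data.Nat using (ℕ; _^_; _+_; _*_; _≥_; _/_)

theorem12 : ∀ {c ℓ : Level} (p r : ℕ) → Prime p → p ≢ 2 → r ≥ 1 →
    (F : FiniteField c ℓ (p ^ (2 * r))) →
    OχEq F ((p ^ r + 1) / 2) (p ^ r)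
theorem12 p r p-prime p≢2 r≥1 F with Arithmetic.oddPrimePower p-prime p≢2 r≥1
... | h , 1≤h , pʳ≡1+2h = ≡.subst (λ k → OχEq F k (p ^ r)) (≡.sym k≡1+h)
  ( PaleyColouring.orthColouring F (p ^ r) h 1≤h pʳ≡1+2h q≡n²
      -- The field has exponent `2 * r`, and `r` iterations of Frobenius give the power n = p^r.
      (FiniteFieldTheory.frobenius F p-prime (2 * r) ≡.refl r)
  , λ m m<n (cs , cs⊥) → ℕ.<⇒≱ (ℕ.*-mono-< m<n m<n) (≡.subst (ℕ._≤ m * m) q≡n²
      -- Since `h` is positive there are at least two colourings, and those with indices 0 and 1
      -- suffice.
      (let i = zero ; j = suc (Fin.fromℕ< 1≤h)
       in orthogonal⇒q≤n² F (cs i) (cs j) (cs⊥ i j λ ()))) )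
  where
  q≡n² : p ^ (2 * r) ≡ p ^ r * p ^ r
  q≡n² = ≡.trans (≡.cong (λ k → p ^ (r + k)) (ℕ.+-identityʳ r)) (ℕ.^-distribˡ-+-* p r r)

  k≡1+h : (p ^ r + 1) / 2 ≡ suc h
  k≡1+h = ≡.trans (≡.cong (λ k → (k + 1) / 2) pʳ≡1+2h)
    -- Once commuted, the numerator `1 + (1 + h * 2)` is `suc h * 2` by definition.
    (≡.trans (≡.cong (_/ 2) (ℕ.+-comm (1 + h * 2) 1)) (m*n/n≡m (suc h) 2))
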